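{- For all $n\ge1$, $$q_n=\frac12nH_n-\frac12P_n,\qquad r_n=\frac12nP_n-\frac12P_n=\frac{n-1}{2}P_n.$$
   Context: Let $s=\sqrt3/2$. Consider the standard triangular lattice in the plane whose vertices are the points $(a+b/2,\,bs)$ with $a,b\in\mathbb Z$ and whose edges are the unit segments joining lattice points in the directions $0^\circ,60^\circ,120^\circ$; it divides the plane into unit equilateral triangles called cells. A small tile is a single cell; a large tile is an equilateral triangle of side $2$ whose vertices are lattice points (so it is a union of $4$ cells; it may point up or down). For a region $R$ that is a finite union of cells, a tiling of $R$ is a finite set of small and large tiles, each contained in $R$, with pairwise disjoint interiors and union equal to $R$. For $n\ge1$, the region $H_n$ is the union of the trapezoid with vertices $(0,0),(n,0),(n-\tfrac12,s),(\tfrac12,s)$ and the trapezoid with vertices $(\tfrac12,s),(n-\tfrac12,s),(n,2s),(0,2s)$ ($4n-2$ cells; for $n=1$ two unit triangles meeting at a point), and $P_n$ is $H_n$ with the cell with vertices $(n-1,0),(n,0),(n-\tfrac12,s)$ removed. $H_n$ and $P_n$ also denote the numbers of tilings of these regions; thus $H_n=\frac{(1+\sqrt2)^n+(1-\sqrt2)^n}{2}$ and $P_n=\frac{(1+\sqrt2)^n-(1-\sqrt2)^n}{2\sqrt2}$. Define $q_n$ (resp. $r_n$) as the sum, over all tilings of $H_n$ (resp. $P_n$), of the number of large tiles in the tiling. -}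

module Defs where

open import Data.Nat.Base using (ℕ; _∸_)
import Data.Integer.Base as ℤ
open import Data.Integer.Base using (ℤ; +_; 0ℤ; 1ℤ)
import Data.Integer.Properties as ℤ
open import Data.List.Base
  using (List; []; _∷_; [_]; _++_; map; concatMap; filter; length; upTo)
open import Data.List.Membership.Propositional using (_∈_)
open import Data.List.Membership.Propositional.Properties
  using (∈-map⁺; ∈-++⁺ˡ; ∈-++⁺ʳ; ∈-filter⁺)
open import Data.List.Relation.Binary.Disjoint.Propositional using (Disjoint)
open import Data.List.Relation.Binary.Subset.Propositional using (_⊆_)
open import Data.List.Relation.Unary.All using (All; all?)
open import Data.List.Relation.Unary.AllPairs using (AllPairs; allPairs?)
open import Data.List.Relation.Unary.Any using (here)
open import Data.Nat.ListAction using (sum)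
open import Data.Product.Base using (_×_; _,_)
open import Data.Rational.Base using (ℚ; _/_)
open import Relation.Binary.Definitions using (DecidableEquality)
open import Relation.Binary.PropositionalEquality.Core using (refl)
open import Relation.Nullary.Decidable using (yes; no; ¬?; map′; _×-dec_)
open import Relation.Unary using (Decidable)

-- A pair (a , b) of integers names the lattice point (a + b/2 , b s) of the
-- plane, s = √3/2.  In these lattice coordinates
--   up   a b  is the cell with vertices (a , b), (a+1 , b), (a , b+1);
--   down a b  is the cell with vertices (a+1 , b), (a , b+1), (a+1 , b+1).
-- Every cell is exactly one of these.

data Cell : Set where
  up down : (a b : ℤ) → Cell

infix 4 _≟_

_≟_ : DecidableEquality Cell
up a b ≟ up c d =
  map′ (λ { (refl , refl) → refl }) (λ { refl → refl , refl })
       ((a ℤ.≟ c) ×-dec (b ℤ.≟ d))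
up _ _ ≟ down _ _ = no λ ()
down _ _ ≟ up _ _ = no λ ()
down a b ≟ down c d =
  map′ (λ { (refl , refl) → refl }) (λ { refl → refl , refl })
       ((a ℤ.≟ c) ×-dec (b ℤ.≟ d))

open import Data.List.Relation.Binary.Disjoint.DecPropositional _≟_
  using (disjoint?)
open import Data.List.Relation.Binary.Subset.DecPropositional _≟_
  using (_⊆?_)

-- The cells sharing an edge with a given cell.
neighbours : Cell → List Cell
neighbours (up a b) =
  down a b ∷ down (a ℤ.- 1ℤ) b ∷ down a (b ℤ.- 1ℤ) ∷ []
neighbours (down a b) =
  up a b ∷ up (a ℤ.+ 1ℤ) b ∷ up a (b ℤ.+ 1ℤ) ∷ []

-- A triangle of side 2 with lattice vertices is named by its central cell,
-- whose orientation is opposite to its own: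
--   large (down a b)  points up, with vertices (a , b), (a+2 , b), (a , b+2);
--   large (up a b)    points down, with vertices
--                     (a+1 , b-1), (a-1 , b+1), (a+1 , b+1).
data Tile : Set where
  small large : Cell → Tile

cells : Tile → List Cell
cells (small c) = [ c ]
cells (large c) = c ∷ neighbours c

data IsLarge : Tile → Set where
  large : ∀ {c} → IsLarge (large c)

isLarge? : Decidable IsLarge
isLarge? (small _) = no λ ()
isLarge? (large _) = yes large

numLarge : List Tile → ℕ
numLarge T = length (filter isLarge? T)

-- A region is given by a list of its cells.
Region : Set
Region = List Cell

-- Tiles and regions being unions of cells, two tiles have disjoint interiors
-- exactly when they have no cell in common.
IsTiling : Region → List Tile → Set
IsTiling R T =
    All (λ t → cells t ⊆ R) T
  × AllPairs (λ t u → Disjoint (cells t) (cells u)) T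
  × R ⊆ concatMap cells T

isTiling? : ∀ R → Decidable (IsTiling R)
isTiling? R T =
  all? (λ t → cells t ⊆? R) T
  ×-dec allPairs? (λ t u → disjoint? (cells t) (cells u)) T
  ×-dec (R ⊆? concatMap cells T)

sublists : ∀ {A : Set} → List A → List (List A)
sublists []       = [ [] ]
sublists (x ∷ xs) = map (x ∷_) (sublists xs) ++ sublists xs

-- The tiles contained in R.  A large tile contained in R has its central cell
-- in R, so none is missed (see ⊆⇒∈tilesIn); if the cells of R are listed
-- without repetition, so are the tiles.
tilesIn : Region → List Tile
tilesIn R = filter (λ t → cells t ⊆? R) (map small R ++ map large R)

⊆⇒∈tilesIn : ∀ R t → cells t ⊆ R → t ∈ tilesIn R
⊆⇒∈tilesIn R (small c) t⊆R =
  ∈-filter⁺ (λ t → cells t ⊆? R) (∈-++⁺ˡ (∈-map⁺ small (t⊆R (here refl)))) t⊆R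
⊆⇒∈tilesIn R (large c) t⊆R =
  ∈-filter⁺ (λ t → cells t ⊆? R)
    (∈-++⁺ʳ (map small R) (∈-map⁺ large (t⊆R (here refl)))) t⊆R

-- All tilings of R.  A tiling is a finite set of tiles; each set of tiles
-- contained in R is represented once, by the sublist of tilesIn R having these
-- tiles as entries (R listed without repetition).
tilings : Region → List (List Tile)
tilings R = filter (isTiling? R) (sublists (tilesIn R))

numTilings : Region → ℕ
numTilings R = length (tilings R)

totalLarge : Region → ℕ
totalLarge R = sum (map numLarge (tilings R))

-- For n ≥ 1.  The trapezoid between heights 0 and s has, in lattice
-- coordinates, the vertices (0 , 0), (n , 0), (n-1 , 1), (0 , 1).
lowerTrapezoid : ℕ → Region
lowerTrapezoid n =
  map (λ i → up (+ i) 0ℤ) (upTo n) ++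
  map (λ i → down (+ i) 0ℤ) (upTo (n ∸ 1))

-- For n ≥ 1.  The trapezoid between heights s and 2s has, in lattice
-- coordinates, the vertices (0 , 1), (n-1 , 1), (n-1 , 2), (-1 , 2).
upperTrapezoid : ℕ → Region
upperTrapezoid n =
  map (λ i → down (+ i ℤ.- 1ℤ) 1ℤ) (upTo n) ++
  map (λ i → up (+ i) 1ℤ) (upTo (n ∸ 1))

regionH : ℕ → Region
regionH n = lowerTrapezoid n ++ upperTrapezoid n

-- The removed cell has vertices (n-1 , 0), (n , 0), (n-1 , 1) in lattice
-- coordinates.
regionP : ℕ → Region
regionP n = filter (λ c → ¬? (c ≟ up (+ n ℤ.- 1ℤ) 0ℤ)) (regionH n)

H P q r : ℕ → ℕ
H n = numTilings (regionH n)
P n = numTilings (regionP n)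
q n = totalLarge (regionH n)
r n = totalLarge (regionP n)

fromℕ : ℕ → ℚ
fromℕ n = + n / 1

{-# OPTIONS --safe #-}

-- A tiling is determined by its set of large tiles, which can be any set of
-- pairwise disjoint ones.  In H_(m+1) there are two large tiles Uᵢ (pointing
-- up) and Dᵢ (pointing down) for each i < m, and the only overlapping pairs are
-- Uᵢ Dᵢ, Uᵢ Uᵢ₊₁ and Dᵢ Dᵢ₊₁; in P_(m+1) the tile Uₘ₋₁ is missing.  Deciding on
-- the last two tiles gives, using the symmetry exchanging U and D,
--   H_(n+1) = H_n + 2 P_n,   q_(n+1) = q_n + 2 (r_n + P_n),
--   P_(n+1) = H_n + P_n,     r_(n+1) = q_n + (r_n + P_n),
-- from which 2 q_n + P_n = n H_n and 2 r_n = (n - 1) P_n follow by induction.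

module Submission where

open import Defs
open import Data.Nat.Base using (ℕ; _≤_)
open import Data.Product.Base using (_×_)
open import Data.Rational.Base using (½; 1ℚ; _*_; _-_)
open import Relation.Binary.PropositionalEquality.Core using (_≡_)

open import Data.Bool.Base using (true; false; if_then_else_)
open import Data.Nat.Base as ℕ using (zero; suc; _+_; _<_; z≤n; s≤s)
import Data.Nat.Properties as ℕ
open import Data.Nat.ListAction using (sum)
open import Data.Nat.ListAction.Properties using (sum-++)
open import Data.Nat.Tactic.RingSolver using (solve-∀)
import Data.Integer.Base as ℤ
open import Data.Integer.Base using (ℤ; +_; 0ℤ; 1ℤ)
import Data.Integer.Properties as ℤ
open import Algebra.Bundles using (module AbelianGroup)
open import Algebra.Properties.Group (AbelianGroup.group ℤ.+-0-abelianGroup) using (∙-cancelʳ)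
import Data.Integer.Tactic.RingSolver as ℤSolver
import Data.Rational.Base as ℚ
import Data.Rational.Properties as ℚ
import Data.Rational.Solver as ℚSolver
import Data.Rational.Unnormalised.Base as ℚᵘ
import Data.Rational.Unnormalised.Properties as ℚᵘ
open import Data.List.Base
  using (List; []; _∷_; _++_; map; concatMap; filter; length; upTo)
open import Data.List.Properties
  using (map-++; map-∘; filter-all; filter-accept; filter-reject; filter-++;
         filter-none)
open import Data.List.Membership.Propositional using (_∈_; _∉_; find; lose)
open import Data.List.Membership.Propositional.Properties
open import Data.List.Relation.Binary.Disjoint.Propositional using (Disjoint)
open import Data.List.Relation.Binary.Disjoint.DecPropositional _≟_
  using (disjoint?)
open import Data.List.Relation.Binary.Subset.Propositional using (_⊆_)
open import Data.List.Relation.Binary.Subset.DecPropositional _≟_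
  using (_⊆?_)
open import Data.List.Membership.DecPropositional _≟_ using (_∈?_)
open import Data.List.Relation.Binary.Permutation.Propositional
  using (_↭_; prep; swap; ↭-refl; ↭-sym; ↭-trans; ↭⇒↭ₛ)
  renaming (refl to ↭-refl′; trans to ↭-trans′)
open import Data.List.Relation.Binary.Permutation.Propositional.Properties
  using (shift; ∈-resp-↭; ↭-length)
open import Data.List.Relation.Binary.Permutation.Setoid.Properties
  using (AllPairs-resp-↭; Unique-resp-↭)
open import Data.List.Relation.Unary.All as All using (All; []; _∷_)
import Data.List.Relation.Unary.All.Properties as All
open import Data.List.Relation.Unary.AllPairs as AllPairs
  using (AllPairs; allPairs?; []; _∷_)
import Data.List.Relation.Unary.AllPairs.Properties as AllPairs
open import Data.List.Relation.Unary.Any using (here; there)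
open import Data.List.Relation.Unary.Unique.Propositional using (Unique)
import Data.List.Relation.Unary.Unique.Propositional.Properties as Unique
open import Data.Product.Base using (_,_; proj₁; proj₂; ∃)
open import Data.Sum.Base using (inj₁; inj₂)
open import Data.Empty using (⊥-elim)
open import Function.Base using (_∘_; id; const)
open import Relation.Binary.PropositionalEquality
  using (refl; sym; trans; cong; cong₂; subst; setoid; resp₂; _≢_; module ≡-Reasoning)
open import Relation.Nullary using (¬_; Dec; yes; no; does)
open import Relation.Nullary.Decidable using (dec-true; dec-false; ¬?)
open import Relation.Nullary.Negation using (contradiction)
open import Relation.Unary using (Decidable)

-- Decidable conditions as zero-one weights.

private
  variable
    X : Set
    Q Q′ : Set

infix 8 _·_

-- The Iverson bracket of `Q` times `n`. With it, a sum over a filtered list becomes a sum over all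
-- sublists in which unwanted terms are 0.
_·_ : Dec Q → ℕ → ℕ
Q? · n = if does Q? then n else 0

·-true : (Q? : Dec Q) {n : ℕ} → Q → Q? · n ≡ n
·-true Q? q rewrite dec-true Q? q = refl

·-false : (Q? : Dec Q) {n : ℕ} → ¬ Q → Q? · n ≡ 0
·-false Q? ¬q rewrite dec-false Q? ¬q = refl

·-cong : (Q? : Dec Q) (Q′? : Dec Q′) {n : ℕ} → (Q → Q′) → (Q′ → Q) → Q? · n ≡ Q′? · n
·-cong (yes q) Q′? to from = sym (·-true Q′? (to q))
·-cong (no ¬q) Q′? to from = sym (·-false Q′? (¬q ∘ from))

·-+ : (Q? : Dec Q) (m n : ℕ) → Q? · (m + n) ≡ Q? · m + Q? · n
·-+ (yes _) m n = refl
·-+ (no  _) m n = refl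

sum-map-filter : {Q : X → Set} (Q? : Decidable Q) (g : X → ℕ) (xs : List X) →
                 sum (map g (filter Q? xs)) ≡ sum (map (λ x → Q? x · g x) xs)
sum-map-filter Q? g []       = refl
sum-map-filter Q? g (x ∷ xs) with does (Q? x)
... | true  = cong (λ z → g x + z) (sum-map-filter Q? g xs)
... | false = sum-map-filter Q? g xs

length≡sum-map-1 : (xs : List X) → length xs ≡ sum (map (const 1) xs)
length≡sum-map-1 []       = refl
length≡sum-map-1 (x ∷ xs) = cong suc (length≡sum-map-1 xs)

-- Sums over sublists

∑ : List X → (List X → ℕ) → ℕ
∑ xs f = sum (map f (sublists xs))

∑-∷ : (x : X) (xs : List X) (f : List X → ℕ) →
      ∑ (x ∷ xs) f ≡ ∑ xs (f ∘ (x ∷_)) + ∑ xs f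
∑-∷ x xs f = begin
  sum (map f (map (x ∷_) ss ++ ss))           ≡⟨ cong sum (map-++ f (map (x ∷_) ss) ss) ⟩
  sum (map f (map (x ∷_) ss) ++ map f ss)     ≡⟨ sum-++ (map f (map (x ∷_) ss)) _ ⟩
  sum (map f (map (x ∷_) ss)) + sum (map f ss) ≡⟨ cong (λ z → sum z + sum (map f ss)) (sym (map-∘ ss)) ⟩
  sum (map (f ∘ (x ∷_)) ss) + sum (map f ss)  ∎
  where
  open ≡-Reasoning
  ss = sublists xs

∈-sublists-there : ∀ (x : X) xs {s} → s ∈ sublists xs → s ∈ sublists (x ∷ xs)
∈-sublists-there x xs s∈ = ∈-++⁺ʳ (map (x ∷_) (sublists xs)) s∈

∈-sublists-∷ : ∀ (x : X) xs {s} → s ∈ sublists xs → x ∷ s ∈ sublists (x ∷ xs)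
∈-sublists-∷ x xs s∈ = ∈-++⁺ˡ (∈-map⁺ (x ∷_) s∈)

∈-sublists⇒⊆ : ∀ (xs : List X) {s} → s ∈ sublists xs → s ⊆ xs
∈-sublists⇒⊆ []       (here refl) ()
∈-sublists⇒⊆ (x ∷ xs) s∈ y∈ with ∈-++⁻ (map (x ∷_) (sublists xs)) s∈
... | inj₂ s∈′ = there (∈-sublists⇒⊆ xs s∈′ y∈)
... | inj₁ s∈′ with ∈-map⁻ (x ∷_) s∈′ | y∈
...   | _ , _   , refl | here refl = here refl
...   | _ , s∈″ , refl | there y∈′ = there (∈-sublists⇒⊆ xs s∈″ y∈′)

∑-cong : ∀ (xs : List X) {f g} → (∀ {s} → s ∈ sublists xs → f s ≡ g s) → ∑ xs f ≡ ∑ xs g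
∑-cong []       eq = cong (_+ 0) (eq (here refl))
∑-cong (x ∷ xs) {f} {g} eq = begin
  ∑ (x ∷ xs) f                 ≡⟨ ∑-∷ x xs f ⟩
  ∑ xs (f ∘ (x ∷_)) + ∑ xs f   ≡⟨ cong₂ _+_ (∑-cong xs (eq ∘ ∈-sublists-∷ x xs)) (∑-cong xs (eq ∘ ∈-sublists-there x xs)) ⟩
  ∑ xs (g ∘ (x ∷_)) + ∑ xs g   ≡⟨ ∑-∷ x xs g ⟨
  ∑ (x ∷ xs) g                 ∎
  where open ≡-Reasoning

∑-zero : ∀ (xs : List X) {f} → (∀ {s} → s ∈ sublists xs → f s ≡ 0) → ∑ xs f ≡ 0
∑-zero []       eq = trans (ℕ.+-identityʳ _) (eq (here refl))
∑-zero (x ∷ xs) {f} eq = trans (∑-∷ x xs f)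
  (cong₂ _+_ (∑-zero xs (eq ∘ ∈-sublists-∷ x xs)) (∑-zero xs (eq ∘ ∈-sublists-there x xs)))

interchange : ∀ a b c d → (a + b) + (c + d) ≡ (a + c) + (b + d)
interchange = solve-∀

∑-+ : (xs : List X) (f g : List X → ℕ) → ∑ xs (λ s → f s + g s) ≡ ∑ xs f + ∑ xs g
∑-+ []       f g = interchange (f []) (g []) 0 0
∑-+ (x ∷ xs) f g = begin
  ∑ (x ∷ xs) (λ s → f s + g s)
    ≡⟨ ∑-∷ x xs _ ⟩
  ∑ xs (λ s → f (x ∷ s) + g (x ∷ s)) + ∑ xs (λ s → f s + g s)
    ≡⟨ cong₂ _+_ (∑-+ xs _ _) (∑-+ xs f g) ⟩
  (∑ xs (f ∘ (x ∷_)) + ∑ xs (g ∘ (x ∷_))) + (∑ xs f + ∑ xs g)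
    ≡⟨ interchange (∑ xs (f ∘ (x ∷_))) _ _ _ ⟩
  (∑ xs (f ∘ (x ∷_)) + ∑ xs f) + (∑ xs (g ∘ (x ∷_)) + ∑ xs g)
    ≡⟨ cong₂ _+_ (∑-∷ x xs f) (∑-∷ x xs g) ⟨
  ∑ (x ∷ xs) f + ∑ (x ∷ xs) g
    ∎
  where open ≡-Reasoning

-- A sublist of a concatenation splits into a sublist of each part. The second part is summed
-- outermost, so that a set of large tiles can be held fixed while the small tiles vary.
∑-++ : (xs ys : List X) (f : List X → ℕ) →
       ∑ (xs ++ ys) f ≡ ∑ ys (λ t → ∑ xs (λ s → f (s ++ t)))
∑-++ []       ys f = ∑-cong ys λ _ → sym (ℕ.+-identityʳ _)
∑-++ (x ∷ xs) ys f = begin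
  ∑ (x ∷ xs ++ ys) f
    ≡⟨ ∑-∷ x (xs ++ ys) f ⟩
  ∑ (xs ++ ys) (f ∘ (x ∷_)) + ∑ (xs ++ ys) f
    ≡⟨ cong₂ _+_ (∑-++ xs ys _) (∑-++ xs ys f) ⟩
  ∑ ys (λ t → ∑ xs (λ s → f (x ∷ s ++ t))) + ∑ ys (λ t → ∑ xs (λ s → f (s ++ t)))
    ≡⟨ ∑-+ ys _ _ ⟨
  ∑ ys (λ t → ∑ xs (λ s → f (x ∷ s ++ t)) + ∑ xs (λ s → f (s ++ t)))
    ≡⟨ ∑-cong ys (λ {t} _ → sym (∑-∷ x xs (λ s → f (s ++ t)))) ⟩
  ∑ ys (λ t → ∑ (x ∷ xs) (λ s → f (s ++ t)))
    ∎
  where open ≡-Reasoning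

∑-↭ : {xs ys : List X} {f : List X → ℕ} → (∀ {s t} → s ↭ t → f s ≡ f t) →
      xs ↭ ys → ∑ xs f ≡ ∑ ys f
∑-↭ resp ↭-refl′ = refl
∑-↭ {f = f} resp (prep {xs} {ys} x p) = begin
  ∑ (x ∷ xs) f                 ≡⟨ ∑-∷ x xs f ⟩
  ∑ xs (f ∘ (x ∷_)) + ∑ xs f   ≡⟨ cong₂ _+_ (∑-↭ (resp ∘ prep x) p) (∑-↭ resp p) ⟩
  ∑ ys (f ∘ (x ∷_)) + ∑ ys f   ≡⟨ ∑-∷ x ys f ⟨
  ∑ (x ∷ ys) f                 ∎
  where open ≡-Reasoning
∑-↭ {f = f} resp (swap {xs} {ys} x y p) = begin
  ∑ (x ∷ y ∷ xs) f
    ≡⟨ expand x y xs ⟩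
  (∑ xs (λ s → f (x ∷ y ∷ s)) + ∑ xs (f ∘ (x ∷_))) + (∑ xs (f ∘ (y ∷_)) + ∑ xs f)
    -- The sublists with only `x` and those with only `y` trade places; those with both need the
    -- invariance of `f` under swapping the two heads.
    ≡⟨ interchange (∑ xs (λ s → f (x ∷ y ∷ s))) _ _ _ ⟩
  (∑ xs (λ s → f (x ∷ y ∷ s)) + ∑ xs (f ∘ (y ∷_))) + (∑ xs (f ∘ (x ∷_)) + ∑ xs f)
    ≡⟨ cong₂ _+_
         (cong₂ _+_ (trans (∑-cong xs (λ _ → resp (swap x y ↭-refl)))
                           (∑-↭ (λ q → resp (prep y (prep x q))) p))
                    (∑-↭ (resp ∘ prep y) p))
         (cong₂ _+_ (∑-↭ (resp ∘ prep x) p) (∑-↭ resp p)) ⟩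
  (∑ ys (λ s → f (y ∷ x ∷ s)) + ∑ ys (f ∘ (y ∷_))) + (∑ ys (f ∘ (x ∷_)) + ∑ ys f)
    ≡⟨ expand y x ys ⟨
  ∑ (y ∷ x ∷ ys) f
    ∎
  where
  open ≡-Reasoning
  expand : ∀ a b zs → ∑ (a ∷ b ∷ zs) f ≡
    (∑ zs (λ s → f (a ∷ b ∷ s)) + ∑ zs (f ∘ (a ∷_))) + (∑ zs (f ∘ (b ∷_)) + ∑ zs f)
  expand a b zs = trans (∑-∷ a (b ∷ zs) f) (cong₂ _+_ (∑-∷ b zs _) (∑-∷ b zs f))
∑-↭ resp (↭-trans′ p q) = trans (∑-↭ resp p) (∑-↭ resp q)

∑-filter : {C : X → Set} (C? : Decidable C) (xs : List X) {f : List X → ℕ} →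
           (∀ {s} → ¬ All C s → f s ≡ 0) → ∑ xs f ≡ ∑ (filter C? xs) f
∑-filter C? []       f≡0 = refl
∑-filter C? (x ∷ xs) {f} f≡0 with C? x
... | yes c = begin
  ∑ (x ∷ xs) f
    ≡⟨ ∑-∷ x xs f ⟩
  ∑ xs (f ∘ (x ∷_)) + ∑ xs f
    ≡⟨ cong₂ _+_ (∑-filter C? xs (λ ¬all → f≡0 (¬all ∘ All.tail))) (∑-filter C? xs f≡0) ⟩
  ∑ (filter C? xs) (f ∘ (x ∷_)) + ∑ (filter C? xs) f
    ≡⟨ ∑-∷ x (filter C? xs) f ⟨
  ∑ (x ∷ filter C? xs) f
    ∎
  where open ≡-Reasoning
... | no ¬c = begin
  ∑ (x ∷ xs) f                 ≡⟨ ∑-∷ x xs f ⟩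
  ∑ xs (f ∘ (x ∷_)) + ∑ xs f   ≡⟨ cong₂ _+_ (∑-zero xs (λ _ → f≡0 (¬c ∘ All.head))) (∑-filter C? xs f≡0) ⟩
  ∑ (filter C? xs) f           ∎
  where open ≡-Reasoning

-- When the entries of `xs` are distinct, a sublist is determined by its members, so a single
-- sublist has exactly the entries satisfying `C` as members. At each entry one of the two choices
-- is forced and the other contributes 0.
∑-single : {C : X → Set} (C? : Decidable C) (xs : List X) {f : List X → ℕ} → Unique xs →
           (∀ {s} → s ∈ sublists xs →
             ¬ (∀ {x} → x ∈ xs → (x ∈ s → C x) × (C x → x ∈ s)) → f s ≡ 0) →
           ∑ xs f ≡ f (filter C? xs)
∑-single C? []       u f≡0 = ℕ.+-identityʳ _
∑-single {C = C} C? (x ∷ xs) {f} (x∉ ∷ u) f≡0 with C? x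
... | yes c = begin
  ∑ (x ∷ xs) f                 ≡⟨ ∑-∷ x xs f ⟩
  ∑ xs (f ∘ (x ∷_)) + ∑ xs f   ≡⟨ cong₂ _+_ (∑-single C? xs u rest) (∑-zero xs without) ⟩
  f (x ∷ filter C? xs) + 0     ≡⟨ ℕ.+-identityʳ _ ⟩
  f (x ∷ filter C? xs)         ∎
  where
  open ≡-Reasoning
  rest : ∀ {s} → s ∈ sublists xs →
         ¬ (∀ {y} → y ∈ xs → (y ∈ s → C y) × (C y → y ∈ s)) → f (x ∷ s) ≡ 0
  rest {s} s∈ ¬same = f≡0 (∈-sublists-∷ x xs s∈) λ same → ¬same λ {y} y∈ →
    (λ y∈s → proj₁ (same (there y∈)) (there y∈s)) ,
    (λ cy → drop y∈ (proj₂ (same (there y∈)) cy))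
    where
    drop : ∀ {y} → y ∈ xs → y ∈ x ∷ s → y ∈ s
    drop y∈ (here refl) = contradiction refl (All.lookup x∉ y∈)
    drop y∈ (there y∈s) = y∈s
  without : ∀ {s} → s ∈ sublists xs → f s ≡ 0
  without s∈ = f≡0 (∈-sublists-there x xs s∈) λ same →
    All.lookup x∉ (∈-sublists⇒⊆ xs s∈ (proj₂ (same (here refl)) c)) refl
... | no ¬c = begin
  ∑ (x ∷ xs) f                 ≡⟨ ∑-∷ x xs f ⟩
  ∑ xs (f ∘ (x ∷_)) + ∑ xs f   ≡⟨ cong₂ _+_ (∑-zero xs with-x) (∑-single C? xs u rest) ⟩
  f (filter C? xs)             ∎
  where
  open ≡-Reasoning
  rest : ∀ {s} → s ∈ sublists xs →
         ¬ (∀ {y} → y ∈ xs → (y ∈ s → C y) × (C y → y ∈ s)) → f s ≡ 0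
  rest s∈ ¬same = f≡0 (∈-sublists-there x xs s∈) λ same → ¬same (same ∘ there)
  with-x : ∀ {s} → s ∈ sublists xs → f (x ∷ s) ≡ 0
  with-x s∈ = f≡0 (∈-sublists-∷ x xs s∈) λ same → ¬c (proj₁ (same (here refl)) (here refl))

-- Tilings and pairwise disjoint sets of large tiles

infix 4 _#_ _#?_

_#_ : Tile → Tile → Set
t # u = Disjoint (cells t) (cells u)

_#?_ : ∀ t u → Dec (t # u)
t #? u = disjoint? (cells t) (cells u)

#-sym : ∀ {t u} → t # u → u # t
#-sym t#u (v∈u , v∈t) = t#u (v∈t , v∈u)

PairwiseDisjoint : List Tile → Set
PairwiseDisjoint = AllPairs _#_

pairwiseDisjoint? : Decidable PairwiseDisjoint
pairwiseDisjoint? = allPairs? _#?_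

AllPairs-++⁻ʳ : ∀ {R : X → X → Set} xs {ys} → AllPairs R (xs ++ ys) → AllPairs R ys
AllPairs-++⁻ʳ []       ps       = ps
AllPairs-++⁻ʳ (x ∷ xs) (_ ∷ ps) = AllPairs-++⁻ʳ xs ps

AllPairs-++⁻-cross : ∀ {R : X → X → Set} {xs ys x} →
                     AllPairs R (xs ++ ys) → x ∈ xs → All (R x) ys
AllPairs-++⁻-cross {xs = _ ∷ xs} (p ∷ _)  (here refl) = All.++⁻ʳ xs p
AllPairs-++⁻-cross               (_ ∷ ps) (there x∈)  = AllPairs-++⁻-cross ps x∈

-- The weight w = const 1 counts tilings, and w = id counts their large tiles.
packings : (ℕ → ℕ) → List Tile → ℕ
packings w ts = ∑ ts λ S → pairwiseDisjoint? S · w (length S)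

largeTiles : Region → List Tile
largeTiles R = filter (λ t → cells t ⊆? R) (map large R)

tilesIn≡small++large : ∀ R → tilesIn R ≡ map small R ++ largeTiles R
tilesIn≡small++large R = trans (filter-++ _ (map small R) (map large R))
  (cong (_++ largeTiles R) (filter-all _ (All.tabulate small⊆R)))
  where
  small⊆R : ∀ {t} → t ∈ map small R → cells t ⊆ R
  small⊆R t∈ with ∈-map⁻ small t∈
  ... | c , c∈R , refl = λ { (here refl) → c∈R }

module _ {R : Region} (R! : Unique R) (w : ℕ → ℕ)
         {S : List Tile} (S∈ : S ∈ sublists (largeTiles R)) where

  -- For pairwise disjoint `S` this is the only set of small tiles that completes `S` to a tiling:
  -- one for each cell that `S` leaves uncovered.
  filling : List Tile
  filling = filter (λ t → All.all? (t #?_) S) (map small R)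

  private
    S⊆R : ∀ {t} → t ∈ S → cells t ⊆ R
    S⊆R t∈S = proj₂ (∈-filter⁻ (λ t → cells t ⊆? R)
                      {xs = map large R} (∈-sublists⇒⊆ (largeTiles R) S∈ t∈S))

    S-large : All IsLarge S
    S-large = All.tabulate λ t∈S → isLarge
      (∈-map⁻ large (proj₁ (∈-filter⁻ (λ t → cells t ⊆? R)
                             (∈-sublists⇒⊆ (largeTiles R) S∈ t∈S))))
      where
      isLarge : ∀ {t} → (∃ λ c → c ∈ R × t ≡ large c) → IsLarge t
      isLarge (_ , _ , refl) = large

    filling⁻ : ∀ {t} → t ∈ filling → (∃ λ c → c ∈ R × t ≡ small c) × All (t #_) S
    filling⁻ t∈ with ∈-filter⁻ (λ t → All.all? (t #?_) S) {xs = map small R} t∈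
    ... | t∈R , t#S = ∈-map⁻ small t∈R , t#S

  numLarge-filling : numLarge (filling ++ S) ≡ length S
  numLarge-filling = cong length (begin
    filter isLarge? (filling ++ S)                    ≡⟨ filter-++ isLarge? filling S ⟩
    filter isLarge? filling ++ filter isLarge? S      ≡⟨ cong₂ _++_
                                                           (filter-none isLarge? (All.tabulate (notLarge ∘ proj₁ ∘ filling⁻)))
                                                           (filter-all isLarge? S-large) ⟩
    S                                                 ∎)
    where
    open ≡-Reasoning
    notLarge : ∀ {t} → (∃ λ c → c ∈ R × t ≡ small c) → ¬ IsLarge t
    notLarge (_ , _ , refl) ()

  filling-isTiling : PairwiseDisjoint S → IsTiling R (filling ++ S)
  filling-isTiling S# =
      All.++⁺ (All.tabulate (small⊆R ∘ proj₁ ∘ filling⁻)) (All.tabulate S⊆R)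
    , AllPairs.++⁺ (AllPairs.filter⁺ _ (AllPairs.map⁺ (AllPairs.map small# R!)))
                   S# (All.tabulate (proj₂ ∘ filling⁻))
    , covers
    where
    small⊆R : ∀ {t} → (∃ λ c → c ∈ R × t ≡ small c) → cells t ⊆ R
    small⊆R (_ , c∈R , refl) (here refl) = c∈R

    small# : ∀ {c d} → c ≢ d → small c # small d
    small# c≢d (here refl , here refl) = c≢d refl

    covers : R ⊆ concatMap cells (filling ++ S)
    -- A cell not covered by `S` has its small tile disjoint from all of `S`, hence in `filling`.
    covers {c} c∈R with c ∈? concatMap cells S
    ... | yes c∈S with t , t∈S , c∈t ← find (∈-concatMap⁻ cells {xs = S} c∈S) =
      ∈-concatMap⁺ cells (lose (∈-++⁺ʳ filling t∈S) c∈t)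
    ... | no c∉S =
      ∈-concatMap⁺ cells (lose (∈-++⁺ˡ {xs = filling} c∈filling) (here refl))
      where
      c∈filling : small c ∈ filling
      c∈filling = ∈-filter⁺ (λ t → All.all? (t #?_) S) (∈-map⁺ small c∈R)
        (All.tabulate λ { t∈S (here refl , c∈t) →
          c∉S (∈-concatMap⁺ cells (lose t∈S c∈t)) })

  -- Disjointness excludes the small tiles that meet `S`. Covering forces all the others, because a
  -- cell outside the tiles of `S` can only be covered by its own small tile.
  tiling⇒filling : ∀ {s} → s ∈ sublists (map small R) → IsTiling R (s ++ S) →
                   ∀ {t} → t ∈ map small R →
                   (t ∈ s → All (t #_) S) × (All (t #_) S → t ∈ s)
  tiling⇒filling {s} s∈ (_ , disj , covers) t∈ =
    AllPairs-++⁻-cross disj , λ t#S → covered (∈-map⁻ small t∈) t#S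
    where
    covered : ∀ {t} → (∃ λ c → c ∈ R × t ≡ small c) → All (t #_) S → t ∈ s
    covered (c , c∈R , refl) t#S
      with u , u∈ , c∈u ← find (∈-concatMap⁻ cells {xs = s ++ S} (covers c∈R))
      with ∈-++⁻ s u∈
    ... | inj₂ u∈S = ⊥-elim (All.lookup t#S u∈S (here refl , c∈u))
    ... | inj₁ u∈s with ∈-map⁻ small (∈-sublists⇒⊆ (map small R) s∈ u∈s) | c∈u
    ...   | _ , _ , refl | here refl = u∈s

  ∑-fillings : ∑ (map small R) (λ s → isTiling? R (s ++ S) · w (numLarge (s ++ S))) ≡
               pairwiseDisjoint? S · w (length S)
  ∑-fillings = begin
    ∑ (map small R) (λ s → isTiling? R (s ++ S) · w (numLarge (s ++ S)))
      ≡⟨ ∑-single _ (map small R) (Unique.map⁺ (λ { refl → refl }) R!)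
           (λ {s} s∈ ¬same → ·-false (isTiling? R (s ++ S)) (λ T → ¬same (tiling⇒filling s∈ T))) ⟩
    isTiling? R (filling ++ S) · w (numLarge (filling ++ S))
      ≡⟨ cong (λ k → isTiling? R (filling ++ S) · w k) numLarge-filling ⟩
    isTiling? R (filling ++ S) · w (length S)
      ≡⟨ ·-cong (isTiling? R (filling ++ S)) (pairwiseDisjoint? S)
           (λ T → AllPairs-++⁻ʳ filling (proj₁ (proj₂ T))) filling-isTiling ⟩
    pairwiseDisjoint? S · w (length S)
      ∎
    where open ≡-Reasoning

-- The sum is grouped by the set of large tiles: a pairwise disjoint set extends to exactly one
-- tiling by `filling`, any other set to none.
sum-tilings : ∀ {R} → Unique R → (w : ℕ → ℕ) →
              sum (map (w ∘ numLarge) (tilings R)) ≡ packings w (largeTiles R)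
sum-tilings {R} R! w = begin
  sum (map (w ∘ numLarge) (tilings R))
    ≡⟨ sum-map-filter (isTiling? R) (w ∘ numLarge) (sublists (tilesIn R)) ⟩
  ∑ (tilesIn R) f
    ≡⟨ cong (λ ts → ∑ ts f) (tilesIn≡small++large R) ⟩
  ∑ (map small R ++ largeTiles R) f
    ≡⟨ ∑-++ (map small R) (largeTiles R) f ⟩
  ∑ (largeTiles R) (λ S → ∑ (map small R) (λ s → f (s ++ S)))
    ≡⟨ ∑-cong (largeTiles R) (∑-fillings R! w) ⟩
  packings w (largeTiles R)
    ∎
  where
  open ≡-Reasoning
  f : List Tile → ℕ
  f T = isTiling? R T · w (numLarge T)

packings-↭ : ∀ w {ts us} → ts ↭ us → packings w ts ≡ packings w us
packings-↭ w = ∑-↭ λ {s} {t} s↭t →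
  trans (cong (λ k → pairwiseDisjoint? s · w k) (↭-length s↭t))
        (·-cong (pairwiseDisjoint? s) (pairwiseDisjoint? t) (resp s↭t) (resp (↭-sym s↭t)))
  where
  resp : ∀ {s t} → s ↭ t → PairwiseDisjoint s → PairwiseDisjoint t
  resp s↭t = AllPairs-resp-↭ (setoid Tile) (λ {t} {u} → #-sym {t} {u}) (resp₂ _#_) (↭⇒↭ₛ s↭t)

-- Either `t` is chosen, which leaves the tiles disjoint from it and raises the number of tiles by
-- one, or `t` is left out.
packings-∷ : ∀ w t ts →
  packings w (t ∷ ts) ≡ packings (w ∘ suc) (filter (t #?_) ts) + packings w ts
packings-∷ w t ts = begin
  packings w (t ∷ ts)
    ≡⟨ ∑-∷ t ts _ ⟩
  ∑ ts (λ S → pairwiseDisjoint? (t ∷ S) · w (suc (length S))) + packings w ts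
    ≡⟨ cong (_+ packings w ts) (∑-filter (t #?_) ts
         (λ {S} ¬t#S → ·-false (pairwiseDisjoint? (t ∷ S)) (¬t#S ∘ AllPairs.head))) ⟩
  ∑ (filter (t #?_) ts) (λ S → pairwiseDisjoint? (t ∷ S) · w (suc (length S))) + packings w ts
    ≡⟨ cong (_+ packings w ts) (∑-cong (filter (t #?_) ts) λ {S} S∈ →
         ·-cong (pairwiseDisjoint? (t ∷ S)) (pairwiseDisjoint? S) AllPairs.tail
           (All.tabulate (λ u∈S → proj₂ (∈-filter⁻ (t #?_) {xs = ts}
              (∈-sublists⇒⊆ (filter (t #?_) ts) S∈ u∈S))) ∷_)) ⟩
  packings (w ∘ suc) (filter (t #?_) ts) + packings w ts
    ∎
  where open ≡-Reasoning

-- A tile chosen in every packing adds one to each count; this is the source of the terms `P_n` in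
-- the recurrences for `q` and `r`.
packings-suc : ∀ ts → packings suc ts ≡ packings (const 1) ts + packings id ts
packings-suc ts = trans
  (∑-cong ts (λ {S} _ → ·-+ (pairwiseDisjoint? S) 1 (length S)))
  (∑-+ ts _ _)

-- The head of `xs` is located in `ys`, moved to the front and removed from both lists. This allows
-- `largeTiles` to be replaced by a list ordered by column.
unique⇒↭ : ∀ {xs ys : List X} → Unique xs → Unique ys → xs ⊆ ys → ys ⊆ xs → xs ↭ ys
unique⇒↭ {xs = []}     {[]}     _ _ _ _ = ↭-refl
unique⇒↭ {xs = []}     {y ∷ ys} _ _ _ ys⊆ with () ← ys⊆ (here refl)
unique⇒↭ {X = X} {xs = x ∷ xs} (x∉xs ∷ xs!) ys! xs⊆ ys⊆
  with as , bs , refl ← ∈-∃++ (xs⊆ (here refl))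
  with x∉ ∷ as++bs! ← Unique-resp-↭ (setoid X) (↭⇒↭ₛ (shift x as bs)) ys!
  = ↭-trans (prep x (unique⇒↭ xs! as++bs! to from)) (↭-sym (shift x as bs))
  where
  to : xs ⊆ as ++ bs
  to y∈xs with ∈-resp-↭ (shift x as bs) (xs⊆ (there y∈xs))
  ... | here refl = contradiction refl (All.lookup x∉xs y∈xs)
  ... | there y∈  = y∈
  from : as ++ bs ⊆ xs
  from y∈ with ys⊆ (∈-resp-↭ (↭-sym (shift x as bs)) (there y∈))
  ... | here refl  = contradiction refl (All.lookup x∉ y∈)
  ... | there y∈xs = y∈xs

-- The large tiles of the two regions

-- For equal `a` the two tiles are mirror images in the line at height s, and both extend
-- horizontally from `a` to `a + 2`.
upLarge downLarge : ℤ → Tile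
upLarge   a = large (down a 0ℤ)
downLarge a = large (up a 1ℤ)

-- The large tiles of H_(m+1), of P_(m+1), and of the mirror image of P_(m+1)
-- in the line at height s.
chainH chainP chainP′ : ℕ → List Tile
chainH zero    = []
chainH (suc m) = upLarge (+ m) ∷ downLarge (+ m) ∷ chainH m
chainP zero    = []
chainP (suc m) = downLarge (+ m) ∷ chainH m
chainP′ zero    = []
chainP′ (suc m) = upLarge (+ m) ∷ chainH m

data At (i : ℕ) : Tile → Set where
  up   : At i (upLarge (+ i))
  down : At i (downLarge (+ i))

∈-chainH⁻ : ∀ m {t} → t ∈ chainH m → ∃ λ i → i < m × At i t
∈-chainH⁻ (suc m) (here refl)         = m , ℕ.≤-refl , up
∈-chainH⁻ (suc m) (there (here refl)) = m , ℕ.≤-refl , down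
∈-chainH⁻ (suc m) (there (there t∈)) with ∈-chainH⁻ m t∈
... | i , i<m , at = i , ℕ.m<n⇒m<1+n i<m , at

∈-chainH⁺ : ∀ {m i t} → i < m → At i t → t ∈ chainH m
∈-chainH⁺ {suc m} {i} i<1+m at with i ℕ.≟ m | at
... | yes refl | up   = here refl
... | yes refl | down = there (here refl)
... | no  i≢m  | _    =
  there (there (∈-chainH⁺ (ℕ.≤∧≢⇒< (ℕ.≤-pred i<1+m) i≢m) at))

At-unique : ∀ {i j t} → At i t → At j t → i ≡ j
At-unique up   up   = refl
At-unique down down = refl

chainH-fresh : ∀ {m t} → At m t → All (t ≢_) (chainH m)
chainH-fresh {m} at = All.tabulate λ u∈ t≡u → let (i , i<m , at′) = ∈-chainH⁻ m u∈ in
  ℕ.<-irrefl (At-unique (subst (At i) (sym t≡u) at′) at) i<m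

chainH-unique : ∀ m → Unique (chainH m)
chainH-unique zero    = []
chainH-unique (suc m) =
  ((λ ()) ∷ chainH-fresh up) ∷ chainH-fresh down ∷ chainH-unique m

chainP-unique : ∀ m → Unique (chainP m)
chainP-unique zero    = []
chainP-unique (suc m) = chainH-fresh down ∷ chainH-unique m

-- Twice the horizontal position of the centre of a cell, up to a constant.
position : Cell → ℤ
position (up a b)   = a ℤ.+ a ℤ.+ b
position (down a b) = a ℤ.+ a ℤ.+ b ℤ.+ 1ℤ

At⇒position : ∀ {i t v} → At i t → v ∈ cells t →
              ∃ λ k → k ≤ 2 × position v ≡ + (i + i + k)
At⇒position {i} up (here refl) = 1 , s≤s z≤n , eq (+ i)
  where
  eq : ∀ a → a ℤ.+ a ℤ.+ 0ℤ ℤ.+ 1ℤ ≡ a ℤ.+ a ℤ.+ 1ℤ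
  eq = ℤSolver.solve-∀
At⇒position {i} up (there (here refl)) = 0 , z≤n , refl
At⇒position {i} up (there (there (here refl))) = 2 , s≤s (s≤s z≤n) , eq (+ i)
  where
  eq : ∀ a → (a ℤ.+ 1ℤ) ℤ.+ (a ℤ.+ 1ℤ) ℤ.+ 0ℤ ≡ a ℤ.+ a ℤ.+ + 2
  eq = ℤSolver.solve-∀
At⇒position {i} up (there (there (there (here refl)))) = 1 , s≤s z≤n , refl
At⇒position {i} down (here refl) = 1 , s≤s z≤n , refl
At⇒position {i} down (there (here refl)) = 2 , s≤s (s≤s z≤n) , eq (+ i)
  where
  eq : ∀ a → a ℤ.+ a ℤ.+ 1ℤ ℤ.+ 1ℤ ≡ a ℤ.+ a ℤ.+ + 2
  eq = ℤSolver.solve-∀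
At⇒position {i} down (there (there (here refl))) = 0 , z≤n , eq (+ i)
  where
  eq : ∀ a → (a ℤ.- 1ℤ) ℤ.+ (a ℤ.- 1ℤ) ℤ.+ 1ℤ ℤ.+ 1ℤ ≡ a ℤ.+ a ℤ.+ 0ℤ
  eq = ℤSolver.solve-∀
At⇒position {i} down (there (there (there (here refl)))) = 1 , s≤s z≤n , eq (+ i)
  where
  eq : ∀ a → a ℤ.+ a ℤ.+ (1ℤ ℤ.- 1ℤ) ℤ.+ 1ℤ ≡ a ℤ.+ a ℤ.+ 1ℤ
  eq = ℤSolver.solve-∀

-- A common cell would have position at most `2j + 2` as a cell of `u` and at least `2i` as a cell
-- of `t`, whereas `2i` is at least `2j + 4`.
far⇒# : ∀ {i j t u} → At i t → At j u → suc j < i → t # u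
far⇒# {i} {j} at au 1+j<i (v∈t , v∈u)
  with k , _   , eqₜ ← At⇒position at v∈t
  with l , l≤2 , eqᵤ ← At⇒position au v∈u
  = ℕ.<-irrefl (ℤ.+-injective (trans (sym eqᵤ) eqₜ)) (begin-strict
    j + j + l            ≤⟨ ℕ.+-monoʳ-≤ (j + j) l≤2 ⟩
    j + j + 2            <⟨ ℕ.+-monoʳ-< (j + j) (s≤s (s≤s (s≤s (z≤n {1})))) ⟩
    j + j + 4            ≡⟨ eq j ⟩
    (2 + j) + (2 + j)    ≤⟨ ℕ.+-mono-≤ 1+j<i 1+j<i ⟩
    i + i                ≤⟨ ℕ.m≤m+n (i + i) k ⟩
    i + i + k            ∎)
  where
  open ℕ.≤-Reasoning
  eq : ∀ x → x + x + 4 ≡ (2 + x) + (2 + x)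
  eq = solve-∀

chainH-far : ∀ {m t} → At (suc m) t → All (t #_) (chainH m)
chainH-far {m} at = All.tabulate λ u∈ → let (i , i<m , au) = ∈-chainH⁻ m u∈ in
  far⇒# at au (s≤s i<m)

-- Overlaps of large tiles in equal or adjacent columns.

same-column : ∀ a → ¬ (upLarge a # downLarge a)
-- The shared cell is `down a 0ℤ`, the centre of the first tile and a corner of the second.
same-column a t#u = t#u (here refl , there (there (there (here refl))))

upLarge-overlap : ∀ m → ¬ (upLarge (+ suc m) # upLarge (+ m))
upLarge-overlap m t#u =
  -- The shared cell is the left corner of one tile and the right corner of the other; `+ m ℤ.+ 1ℤ`
  -- computes to `+ (m + 1)` and not to `+ suc m`, hence the commutation.
  t#u (there (here refl) , there (there (here (cong (λ i → up (+ i) 0ℤ) (ℕ.+-comm 1 m)))))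

downLarge-overlap : ∀ m → ¬ (downLarge (+ suc m) # downLarge (+ m))
downLarge-overlap m t#u = t#u (there (there (here refl)) , there (here refl))

-- The two tiles have a whole side in common but no cell: any two of their cells differ in
-- orientation, row or column. The same holds for `downLarge#upLarge`.
upLarge#downLarge : ∀ m → upLarge (+ suc m) # downLarge (+ m)
upLarge#downLarge m = λ
  { (here refl , there (there (there (here ()))))
  ; (there (here refl) , here ())
  ; (there (here refl) , there (there (there (here ()))))
  ; (there (there (here refl)) , here ())
  ; (there (there (here refl)) , there (there (there (here ()))))
  ; (there (there (there (here refl))) , here ())
  ; (there (there (there (here refl))) , there (there (there (here ()))))
  }

downLarge#upLarge : ∀ m → downLarge (+ suc m) # upLarge (+ m)
downLarge#upLarge m = λ
  { (here refl , there (here ()))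
  ; (here refl , there (there (here ())))
  ; (here refl , there (there (there (here ()))))
  ; (there (here refl) , here ())
  ; (there (here refl) , there (there (there (here ()))))
  ; (there (there (here refl)) , here ())
  ; (there (there (here refl)) , there (there (there (here ()))))
  ; (there (there (there (here refl))) , here ())
  ; (there (there (there (here refl))) , there (there (there (here ()))))
  }

filter-#-reject : ∀ t u us → ¬ (t # u) → filter (t #?_) (u ∷ us) ≡ filter (t #?_) us
filter-#-reject t u us = filter-reject (t #?_) {u} {us}

filter-#-accept : ∀ t u us → t # u → filter (t #?_) (u ∷ us) ≡ u ∷ filter (t #?_) us
filter-#-accept t u us = filter-accept (t #?_) {u} {us}

-- Among the tiles of earlier columns, only the tile of the same orientation in the preceding column
-- can meet a given one; its removal leaves `chainP m` here and `chainP′ m` in `filter-downLarge`.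
filter-upLarge : ∀ m → filter (upLarge (+ m) #?_) (chainH m) ≡ chainP m
filter-upLarge zero    = refl
filter-upLarge (suc m) = begin
  filter (t #?_) (upLarge (+ m) ∷ downLarge (+ m) ∷ chainH m)
    ≡⟨ filter-#-reject t (upLarge (+ m)) (downLarge (+ m) ∷ chainH m) (upLarge-overlap m) ⟩
  filter (t #?_) (downLarge (+ m) ∷ chainH m)
    ≡⟨ filter-all (t #?_) (upLarge#downLarge m ∷ chainH-far up) ⟩
  downLarge (+ m) ∷ chainH m
    ∎
  where
  open ≡-Reasoning
  t = upLarge (+ suc m)

filter-downLarge : ∀ m → filter (downLarge (+ m) #?_) (chainH m) ≡ chainP′ m
filter-downLarge zero    = refl
filter-downLarge (suc m) = begin
  filter (t #?_) (upLarge (+ m) ∷ downLarge (+ m) ∷ chainH m)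
    ≡⟨ filter-#-accept t (upLarge (+ m)) (downLarge (+ m) ∷ chainH m) (downLarge#upLarge m) ⟩
  upLarge (+ m) ∷ filter (t #?_) (downLarge (+ m) ∷ chainH m)
    ≡⟨ cong (upLarge (+ m) ∷_)
         (filter-#-reject t (downLarge (+ m)) (chainH m) (downLarge-overlap m)) ⟩
  upLarge (+ m) ∷ filter (t #?_) (chainH m)
    ≡⟨ cong (upLarge (+ m) ∷_) (filter-all (t #?_) (chainH-far down)) ⟩
  upLarge (+ m) ∷ chainH m
    ∎
  where
  open ≡-Reasoning
  t = downLarge (+ suc m)

-- The cells of the two regions and the large tiles they contain.

data InH (m : ℕ) : Cell → Set where
  lowerUp   : ∀ {i} → i < suc m → InH m (up (+ i) 0ℤ)
  lowerDown : ∀ {i} → i < m → InH m (down (+ i) 0ℤ)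
  upperDown : ∀ {i} → i < suc m → InH m (down (+ i ℤ.- 1ℤ) 1ℤ)
  upperUp   : ∀ {i} → i < m → InH m (up (+ i) 1ℤ)

InH⇒∈ : ∀ {m c} → InH m c → c ∈ regionH (suc m)
InH⇒∈ (lowerUp i<)   = ∈-++⁺ˡ (∈-++⁺ˡ (∈-map⁺ _ (∈-upTo⁺ i<)))
InH⇒∈ {m} (lowerDown i<) =
  ∈-++⁺ˡ (∈-++⁺ʳ (map (λ i → up (+ i) 0ℤ) (upTo (suc m))) (∈-map⁺ _ (∈-upTo⁺ i<)))
InH⇒∈ {m} (upperDown i<) =
  ∈-++⁺ʳ (lowerTrapezoid (suc m)) (∈-++⁺ˡ (∈-map⁺ (λ i → down (+ i ℤ.- 1ℤ) 1ℤ) (∈-upTo⁺ i<)))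
InH⇒∈ {m} (upperUp i<) =
  ∈-++⁺ʳ (lowerTrapezoid (suc m))
    (∈-++⁺ʳ (map (λ i → down (+ i ℤ.- 1ℤ) 1ℤ) (upTo (suc m))) (∈-map⁺ _ (∈-upTo⁺ i<)))

∈-map-upTo⁻ : ∀ (f : ℕ → X) n {x} → x ∈ map f (upTo n) → ∃ λ i → i < n × x ≡ f i
∈-map-upTo⁻ f n x∈ with i , i∈ , eq ← ∈-map⁻ f {xs = upTo n} x∈ = i , ∈-upTo⁻ i∈ , eq

∈⇒InH : ∀ {m c} → c ∈ regionH (suc m) → InH m c
∈⇒InH {m} c∈ with ∈-++⁻ (lowerTrapezoid (suc m)) c∈
∈⇒InH {m} c∈ | inj₁ c∈l with ∈-++⁻ (map (λ i → up (+ i) 0ℤ) (upTo (suc m))) c∈l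
... | inj₁ c∈′ with _ , i< , refl ← ∈-map-upTo⁻ (λ i → up (+ i) 0ℤ) (suc m) c∈′ = lowerUp i<
... | inj₂ c∈′ with _ , i< , refl ← ∈-map-upTo⁻ (λ i → down (+ i) 0ℤ) m c∈′ = lowerDown i<
∈⇒InH {m} c∈ | inj₂ c∈u with ∈-++⁻ (map (λ i → down (+ i ℤ.- 1ℤ) 1ℤ) (upTo (suc m))) c∈u
... | inj₁ c∈′ with _ , i< , refl ← ∈-map-upTo⁻ (λ i → down (+ i ℤ.- 1ℤ) 1ℤ) (suc m) c∈′ = upperDown i<
... | inj₂ c∈′ with _ , i< , refl ← ∈-map-upTo⁻ (λ i → up (+ i) 1ℤ) m c∈′ = upperUp i<

map-disjoint : ∀ {f g : ℕ → Cell} {is js} → (∀ i j → f i ≢ g j) → Disjoint (map f is) (map g js)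
map-disjoint {f} {g} f≢g (v∈f , v∈g)
  with i , _ , refl ← ∈-map⁻ f v∈f
  with j , _ , eq ← ∈-map⁻ g v∈g = f≢g i j eq

-- Tells the cells of the two trapezoids apart, so that their concatenation has no repetition.
row : Cell → ℤ
row (up a b)   = b
row (down a b) = b

∈-lowerTrapezoid⇒row : ∀ n {c} → c ∈ lowerTrapezoid n → row c ≡ 0ℤ
∈-lowerTrapezoid⇒row n c∈ with ∈-++⁻ (map (λ i → up (+ i) 0ℤ) (upTo n)) c∈
... | inj₁ c∈u with _ , _ , refl ← ∈-map⁻ (λ i → up (+ i) 0ℤ) c∈u = refl
... | inj₂ c∈d with _ , _ , refl ← ∈-map⁻ (λ i → down (+ i) 0ℤ) c∈d = refl

∈-upperTrapezoid⇒row : ∀ n {c} → c ∈ upperTrapezoid n → row c ≡ 1ℤ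
∈-upperTrapezoid⇒row n c∈ with ∈-++⁻ (map (λ i → down (+ i ℤ.- 1ℤ) 1ℤ) (upTo n)) c∈
... | inj₁ c∈d with _ , _ , refl ← ∈-map⁻ (λ i → down (+ i ℤ.- 1ℤ) 1ℤ) c∈d = refl
... | inj₂ c∈u with _ , _ , refl ← ∈-map⁻ (λ i → up (+ i) 1ℤ) c∈u = refl

regionH-unique : ∀ n → Unique (regionH n)
regionH-unique n = Unique.++⁺
  (Unique.++⁺ (Unique.map⁺ (λ { refl → refl }) (Unique.upTo⁺ n))
              (Unique.map⁺ (λ { refl → refl }) (Unique.upTo⁺ (n ℕ.∸ 1)))
              (map-disjoint λ _ _ ()))
  (Unique.++⁺ (Unique.map⁺ (λ eq → ℤ.+-injective (∸1-injective (down-injective eq))) (Unique.upTo⁺ n))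
              (Unique.map⁺ (λ { refl → refl }) (Unique.upTo⁺ (n ℕ.∸ 1)))
              (map-disjoint λ _ _ ()))
  λ (c∈l , c∈u) → 0≢1 (trans (sym (∈-lowerTrapezoid⇒row n c∈l)) (∈-upperTrapezoid⇒row n c∈u))
  where
  0≢1 : 0ℤ ≢ 1ℤ
  0≢1 ()
  down-injective : ∀ {a a′ b b′} → down a b ≡ down a′ b′ → a ≡ a′
  down-injective refl = refl
  ∸1-injective : ∀ {a b} → a ℤ.- 1ℤ ≡ b ℤ.- 1ℤ → a ≡ b
  ∸1-injective {a} {b} = ∙-cancelʳ (ℤ.- 1ℤ) a b

regionP-unique : ∀ n → Unique (regionP n)
regionP-unique n = Unique.filter⁺ _ (regionH-unique n)

-- The removed cell `up (+ suc m ℤ.- 1ℤ) 0ℤ` computes to `up (+ m) 0ℤ`.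
∈-regionP⁺ : ∀ {m c} → InH m c → c ≢ up (+ m) 0ℤ → c ∈ regionP (suc m)
∈-regionP⁺ {m} c∈H c≢ = ∈-filter⁺ (λ c → ¬? (c ≟ up (+ suc m ℤ.- 1ℤ) 0ℤ)) (InH⇒∈ c∈H) c≢

∈-regionP⁻ : ∀ {m c} → c ∈ regionP (suc m) → InH m c × c ≢ up (+ m) 0ℤ
∈-regionP⁻ {m} c∈ with ∈-filter⁻ (λ c → ¬? (c ≟ up (+ suc m ℤ.- 1ℤ) 0ℤ)) {xs = regionH (suc m)} c∈
... | c∈H , c≢ = ∈⇒InH c∈H , c≢

∈-largeTiles⁻ : ∀ {R t} → t ∈ largeTiles R → IsLarge t × cells t ⊆ R
∈-largeTiles⁻ {R} t∈ with ∈-filter⁻ (λ t → cells t ⊆? R) {xs = map large R} t∈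
... | t∈R , t⊆R with _ , _ , refl ← ∈-map⁻ large t∈R = large , t⊆R

∈-largeTiles⁺ : ∀ {R t} → IsLarge t → cells t ⊆ R → t ∈ largeTiles R
∈-largeTiles⁺ {R} large t⊆R =
  ∈-filter⁺ (λ t → cells t ⊆? R) (∈-map⁺ large (t⊆R (here refl))) t⊆R

largeTiles-unique : ∀ {R} → Unique R → Unique (largeTiles R)
largeTiles-unique R! = Unique.filter⁺ _ (Unique.map⁺ (λ { refl → refl }) R!)

At⇒IsLarge : ∀ {i t} → At i t → IsLarge t
At⇒IsLarge up   = large
At⇒IsLarge down = large

At⇒⊆H : ∀ {m i t} → i < m → At i t → ∀ {c} → c ∈ cells t → InH m c
At⇒⊆H i<m up (here refl) = lowerDown i<m
At⇒⊆H i<m up (there (here refl)) = lowerUp (ℕ.m<n⇒m<1+n i<m)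
At⇒⊆H {m} {i} i<m up (there (there (here refl))) =
  subst (λ j → InH m (up (+ j) 0ℤ)) (ℕ.+-comm 1 i) (lowerUp (s≤s i<m))
At⇒⊆H i<m up (there (there (there (here refl)))) = upperUp i<m
At⇒⊆H i<m down (here refl) = upperUp i<m
-- `upperDown` at index `i` names `down (+ i ℤ.- 1ℤ) 1ℤ`, so the cell `down (+ i) 1ℤ` has index
-- `suc i`.
At⇒⊆H i<m down (there (here refl)) = upperDown (s≤s i<m)
At⇒⊆H i<m down (there (there (here refl))) = upperDown (ℕ.m<n⇒m<1+n i<m)
At⇒⊆H i<m down (there (there (there (here refl)))) = lowerDown i<m

-- The centre of the tile decides: an upward cell of the lower row would need a neighbour in row -1,
-- a downward cell of the upper row one in row 2. The remaining cells of the region are the centres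
-- of the tiles in `chainH m`.
⊆H⇒∈chainH : ∀ {m t} → IsLarge t → (∀ {c} → c ∈ cells t → InH m c) → t ∈ chainH m
⊆H⇒∈chainH {m} (large {c}) t⊆H = cases (t⊆H (here refl)) t⊆H
  where
  cases : ∀ {c} → InH m c → (∀ {d} → d ∈ cells (large c) → InH m d) → large c ∈ chainH m
  cases (lowerUp _)     t⊆H with () ← t⊆H (there (there (there (here refl))))
  cases (lowerDown i<m) _   = ∈-chainH⁺ i<m up
  cases (upperDown _)   t⊆H with () ← t⊆H (there (there (there (here refl))))
  cases (upperUp i<m)   _   = ∈-chainH⁺ i<m down

largeTiles-H : ∀ m → largeTiles (regionH (suc m)) ↭ chainH m
largeTiles-H m = unique⇒↭ (largeTiles-unique (regionH-unique (suc m))) (chainH-unique m) to from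
  where
  to : largeTiles (regionH (suc m)) ⊆ chainH m
  to t∈ with ∈-largeTiles⁻ t∈
  ... | lg , t⊆H = ⊆H⇒∈chainH lg (λ c∈ → ∈⇒InH (t⊆H c∈))
  from : chainH m ⊆ largeTiles (regionH (suc m))
  from t∈ with ∈-chainH⁻ m t∈
  ... | i , i<m , at = ∈-largeTiles⁺ (At⇒IsLarge at) λ c∈ → InH⇒∈ (At⇒⊆H i<m at c∈)

-- The removed cell is the right corner of the last upward tile of the chain and lies in no other
-- tile of it.
largeTiles-P : ∀ m → largeTiles (regionP (suc m)) ↭ chainP m
largeTiles-P m = unique⇒↭ (largeTiles-unique (regionP-unique (suc m))) (chainP-unique m) (to m) (from m)
  where
  to : ∀ m → largeTiles (regionP (suc m)) ⊆ chainP m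
  to m t∈ with ∈-largeTiles⁻ {regionP (suc m)} t∈
  ... | lg , t⊆P = without-corner m (⊆H⇒∈chainH lg (λ c∈ → proj₁ (∈-regionP⁻ (t⊆P c∈))))
                                    (λ c∈ → proj₂ (∈-regionP⁻ (t⊆P c∈)) refl)
    where
    without-corner : ∀ m {t} → t ∈ chainH m → up (+ m) 0ℤ ∉ cells t → t ∈ chainP m
    without-corner (suc k) (there t∈)  _      = t∈
    without-corner (suc k) (here refl) corner∉ =
      ⊥-elim (corner∉ (there (there (here (cong (λ i → up (+ i) 0ℤ) (ℕ.+-comm 1 k))))))

  corner∉down : ∀ {i m} → up (+ m) 0ℤ ∉ cells (downLarge (+ i))
  corner∉down (there (there (there (here ()))))

  corner∉up : ∀ {i m} → suc i < m → up (+ m) 0ℤ ∉ cells (upLarge (+ i))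
  corner∉up {i} 1+i<m (there (here refl)) = ℕ.<-asym 1+i<m ℕ.≤-refl
  corner∉up {i} 1+i<m (there (there (here refl))) =
    ℕ.<-irrefl (ℕ.+-comm 1 i) 1+i<m
  corner∉up {i} 1+i<m (there (there (there (here ()))))

  corner∉ : ∀ {i m t} → suc i < m → At i t → up (+ m) 0ℤ ∉ cells t
  corner∉ 1+i<m up   = corner∉up 1+i<m
  corner∉ 1+i<m down = corner∉down

  from : ∀ m → chainP m ⊆ largeTiles (regionP (suc m))
  from (suc k) (here refl) = ∈-largeTiles⁺ large λ c∈ →
    ∈-regionP⁺ (At⇒⊆H ℕ.≤-refl down c∈) (λ { refl → corner∉down c∈ })
  from (suc k) (there t∈) with ∈-chainH⁻ k t∈
  ... | i , i<k , at = ∈-largeTiles⁺ (At⇒IsLarge at) λ c∈ →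
    ∈-regionP⁺ (At⇒⊆H (ℕ.m<n⇒m<1+n i<k) at c∈) (λ { refl → corner∉ (s≤s i<k) at c∈ })

-- Recurrences

module _ (w : ℕ → ℕ) (m : ℕ) where

  open ≡-Reasoning

  -- The decision is on the first tile of the chain. The weight stays arbitrary because choosing a
  -- tile turns `w` into `w ∘ suc`.
  packings-P : packings w (chainP (suc m)) ≡ packings (w ∘ suc) (chainP′ m) + packings w (chainH m)
  packings-P = begin
    packings w (downLarge (+ m) ∷ chainH m)
      ≡⟨ packings-∷ w (downLarge (+ m)) (chainH m) ⟩
    packings (w ∘ suc) (filter (downLarge (+ m) #?_) (chainH m)) + packings w (chainH m)
      ≡⟨ cong (λ ts → packings (w ∘ suc) ts + packings w (chainH m)) (filter-downLarge m) ⟩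
    packings (w ∘ suc) (chainP′ m) + packings w (chainH m)
      ∎

  packings-P′ : packings w (chainP′ (suc m)) ≡ packings (w ∘ suc) (chainP m) + packings w (chainH m)
  packings-P′ = begin
    packings w (upLarge (+ m) ∷ chainH m)
      ≡⟨ packings-∷ w (upLarge (+ m)) (chainH m) ⟩
    packings (w ∘ suc) (filter (upLarge (+ m) #?_) (chainH m)) + packings w (chainH m)
      ≡⟨ cong (λ ts → packings (w ∘ suc) ts + packings w (chainH m)) (filter-upLarge m) ⟩
    packings (w ∘ suc) (chainP m) + packings w (chainH m)
      ∎

  -- Choosing `upLarge (+ m)` rules out its mirror image and the preceding upward tile, if there is
  -- one; leaving it out gives `chainP (suc m)`.
  packings-H : packings w (chainH (suc m)) ≡
               packings (w ∘ suc) (chainP m) + packings w (chainP (suc m))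
  packings-H = begin
    packings w (upLarge (+ m) ∷ downLarge (+ m) ∷ chainH m)
      ≡⟨ packings-∷ w (upLarge (+ m)) (downLarge (+ m) ∷ chainH m) ⟩
    packings (w ∘ suc) (filter (upLarge (+ m) #?_) (downLarge (+ m) ∷ chainH m)) +
      packings w (chainP (suc m))
      ≡⟨ cong (λ ts → packings (w ∘ suc) ts + packings w (chainP (suc m)))
           (trans (filter-#-reject (upLarge (+ m)) (downLarge (+ m)) (chainH m) (same-column (+ m)))
                  (filter-upLarge m)) ⟩
    packings (w ∘ suc) (chainP m) + packings w (chainP (suc m))
      ∎

-- This is the symmetry exchanging U and D, obtained without constructing a reflection: the
-- recurrences for `chainP` and `chainP′` refer to each other. The induction hypothesis is applied
-- to the weight `w ∘ suc`.
packings-P′≡P : ∀ w m → packings w (chainP′ m) ≡ packings w (chainP m)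
packings-P′≡P w zero    = refl
packings-P′≡P w (suc m) = begin
  packings w (chainP′ (suc m))
    ≡⟨ packings-P′ w m ⟩
  packings (w ∘ suc) (chainP m) + packings w (chainH m)
    ≡⟨ cong (_+ packings w (chainH m)) (packings-P′≡P (w ∘ suc) m) ⟨
  packings (w ∘ suc) (chainP′ m) + packings w (chainH m)
    ≡⟨ packings-P w m ⟨
  packings w (chainP (suc m))
    ∎
  where open ≡-Reasoning

numPackings totalPackings : List Tile → ℕ
numPackings   = packings (const 1)
totalPackings = packings id

module _ (m : ℕ) where

  private
    h  = numPackings   (chainH m)
    p  = numPackings   (chainP m)
    hₜ = totalPackings (chainH m)
    pₜ = totalPackings (chainP m)

  numPackings-P : numPackings (chainP (suc m)) ≡ p + h
  numPackings-P = trans (packings-P (const 1) m) (cong (_+ h) (packings-P′≡P (const 1) m))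

  numPackings-H : numPackings (chainH (suc m)) ≡ p + (p + h)
  numPackings-H = trans (packings-H (const 1) m) (cong (λ z → p + z) numPackings-P)

  totalPackings-P : totalPackings (chainP (suc m)) ≡ (p + pₜ) + hₜ
  totalPackings-P = trans (packings-P id m)
    (cong (_+ hₜ) (trans (packings-P′≡P suc m) (packings-suc (chainP m))))

  totalPackings-H : totalPackings (chainH (suc m)) ≡ (p + pₜ) + ((p + pₜ) + hₜ)
  totalPackings-H = trans (packings-H id m)
    (cong₂ _+_ (packings-suc (chainP m)) totalPackings-P)

-- The chains of index `m` belong to n = `suc m`, so the factors `suc m` and `m` are n and n - 1.
totals : ∀ m →
  (2 ℕ.* totalPackings (chainH m) + numPackings (chainP m) ≡ suc m ℕ.* numPackings (chainH m)) ×
  (2 ℕ.* totalPackings (chainP m) ≡ m ℕ.* numPackings (chainP m))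
totals zero = refl , refl
totals (suc m)
  rewrite numPackings-P m | numPackings-H m | totalPackings-P m | totalPackings-H m
  with eqH , eqP ← totals m = stepH , stepP
  where
  open ≡-Reasoning
  h  = numPackings   (chainH m)
  p  = numPackings   (chainP m)
  hₜ = totalPackings (chainH m)
  pₜ = totalPackings (chainP m)

  stepH : 2 ℕ.* ((p + pₜ) + ((p + pₜ) + hₜ)) + (p + h) ≡ suc (suc m) ℕ.* (p + (p + h))
  stepH = begin
    -- Regrouped around the left sides of the two induction hypotheses, the second one taken twice.
    2 ℕ.* ((p + pₜ) + ((p + pₜ) + hₜ)) + (p + h)     ≡⟨ gather p pₜ hₜ h ⟩
    (2 ℕ.* hₜ + p) + 2 ℕ.* (2 ℕ.* pₜ) + 4 ℕ.* p + h  ≡⟨ cong₂ (λ x y → x + 2 ℕ.* y + 4 ℕ.* p + h) eqH eqP ⟩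
    suc m ℕ.* h + 2 ℕ.* (m ℕ.* p) + 4 ℕ.* p + h      ≡⟨ expand m p h ⟩
    suc (suc m) ℕ.* (p + (p + h))                    ∎
    where
    gather : ∀ p pₜ hₜ h → 2 ℕ.* ((p + pₜ) + ((p + pₜ) + hₜ)) + (p + h) ≡
                           (2 ℕ.* hₜ + p) + 2 ℕ.* (2 ℕ.* pₜ) + 4 ℕ.* p + h
    gather = solve-∀
    expand : ∀ m p h → suc m ℕ.* h + 2 ℕ.* (m ℕ.* p) + 4 ℕ.* p + h ≡ suc (suc m) ℕ.* (p + (p + h))
    expand = solve-∀

  stepP : 2 ℕ.* ((p + pₜ) + hₜ) ≡ suc m ℕ.* (p + h)
  stepP = begin
    2 ℕ.* ((p + pₜ) + hₜ)               ≡⟨ gather p pₜ hₜ ⟩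
    (2 ℕ.* hₜ + p) + 2 ℕ.* pₜ + p       ≡⟨ cong₂ (λ x y → x + y + p) eqH eqP ⟩
    suc m ℕ.* h + m ℕ.* p + p           ≡⟨ expand m p h ⟩
    suc m ℕ.* (p + h)                   ∎
    where
    gather : ∀ p pₜ hₜ → 2 ℕ.* ((p + pₜ) + hₜ) ≡ (2 ℕ.* hₜ + p) + 2 ℕ.* pₜ + p
    gather = solve-∀
    expand : ∀ m p h → suc m ℕ.* h + m ℕ.* p + p ≡ suc m ℕ.* (p + h)
    expand = solve-∀

-- Transfer from packings to tilings of the regions.

numTilings≡numPackings : ∀ {R ts} → Unique R → largeTiles R ↭ ts → numTilings R ≡ numPackings ts
numTilings≡numPackings {R} R! R↭ts = trans (length≡sum-map-1 (tilings R))
  (trans (sum-tilings R! (const 1)) (packings-↭ (const 1) R↭ts))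

totalLarge≡totalPackings : ∀ {R ts} → Unique R → largeTiles R ↭ ts → totalLarge R ≡ totalPackings ts
totalLarge≡totalPackings R! R↭ts = trans (sum-tilings R! id) (packings-↭ id R↭ts)

module _ (m : ℕ) where

  H≡ : H (suc m) ≡ numPackings (chainH m)
  H≡ = numTilings≡numPackings (regionH-unique (suc m)) (largeTiles-H m)

  P≡ : P (suc m) ≡ numPackings (chainP m)
  P≡ = numTilings≡numPackings (regionP-unique (suc m)) (largeTiles-P m)

  q≡ : q (suc m) ≡ totalPackings (chainH m)
  q≡ = totalLarge≡totalPackings (regionH-unique (suc m)) (largeTiles-H m)

  r≡ : r (suc m) ≡ totalPackings (chainP m)
  r≡ = totalLarge≡totalPackings (regionP-unique (suc m)) (largeTiles-P m)

2q+P≡nH : ∀ m → 2 ℕ.* q (suc m) + P (suc m) ≡ suc m ℕ.* H (suc m)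
2q+P≡nH m rewrite q≡ m | P≡ m | H≡ m = proj₁ (totals m)

-- Adding P to both sides of 2r = (n - 1)P avoids subtraction and gives the same shape as the
-- equation for `q`, so that `halve` serves both.
2r+P≡nP : ∀ m → 2 ℕ.* r (suc m) + P (suc m) ≡ suc m ℕ.* P (suc m)
2r+P≡nP m rewrite r≡ m | P≡ m =
  trans (cong (_+ numPackings (chainP m)) (proj₂ (totals m))) (ℕ.+-comm (m ℕ.* _) _)

-- Passage to the rationals.

toℚᵘ-fromℕ : ∀ n → ℚ.toℚᵘ (fromℕ n) ℚᵘ.≃ ℚᵘ.mkℚᵘ (+ n) 0
toℚᵘ-fromℕ n = ℚ.toℚᵘ-fromℚᵘ (ℚᵘ.mkℚᵘ (+ n) 0)

-- Both sides are compared as unnormalised fractions with denominator 1, where equality is a cross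
-- multiplication of integers.
fromℕ-+ : ∀ m n → fromℕ (m + n) ≡ fromℕ m ℚ.+ fromℕ n
fromℕ-+ m n = ℚ.toℚᵘ-injective (begin
  ℚ.toℚᵘ (fromℕ (m + n))                         ≈⟨ toℚᵘ-fromℕ (m + n) ⟩
  ℚᵘ.mkℚᵘ (+ (m + n)) 0                          ≈⟨ ℚᵘ.*≡* (eq (+ m) (+ n)) ⟩
  ℚᵘ.mkℚᵘ (+ m) 0 ℚᵘ.+ ℚᵘ.mkℚᵘ (+ n) 0           ≈⟨ ℚᵘ.+-cong (toℚᵘ-fromℕ m) (toℚᵘ-fromℕ n) ⟨
  ℚ.toℚᵘ (fromℕ m) ℚᵘ.+ ℚ.toℚᵘ (fromℕ n)         ≈⟨ ℚ.toℚᵘ-homo-+ (fromℕ m) (fromℕ n) ⟨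
  ℚ.toℚᵘ (fromℕ m ℚ.+ fromℕ n)                   ∎)
  where
  open import Relation.Binary.Reasoning.Setoid ℚᵘ.≃-setoid
  eq : ∀ a b → (a ℤ.+ b) ℤ.* 1ℤ ≡ (a ℤ.* 1ℤ ℤ.+ b ℤ.* 1ℤ) ℤ.* 1ℤ
  eq = ℤSolver.solve-∀

fromℕ-* : ∀ m n → fromℕ (m ℕ.* n) ≡ fromℕ m * fromℕ n
fromℕ-* m n = ℚ.toℚᵘ-injective (begin
  ℚ.toℚᵘ (fromℕ (m ℕ.* n))                       ≈⟨ toℚᵘ-fromℕ (m ℕ.* n) ⟩
  ℚᵘ.mkℚᵘ (+ (m ℕ.* n)) 0                        ≈⟨ ℚᵘ.*≡* (cong (ℤ._* 1ℤ) (ℤ.pos-* m n)) ⟩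
  ℚᵘ.mkℚᵘ (+ m) 0 ℚᵘ.* ℚᵘ.mkℚᵘ (+ n) 0           ≈⟨ ℚᵘ.*-cong (toℚᵘ-fromℕ m) (toℚᵘ-fromℕ n) ⟨
  ℚ.toℚᵘ (fromℕ m) ℚᵘ.* ℚ.toℚᵘ (fromℕ n)         ≈⟨ ℚ.toℚᵘ-homo-* (fromℕ m) (fromℕ n) ⟨
  ℚ.toℚᵘ (fromℕ m * fromℕ n)                     ∎)
  where open import Relation.Binary.Reasoning.Setoid ℚᵘ.≃-setoid

halve : ∀ t p n h → 2 ℕ.* t + p ≡ n ℕ.* h →
        fromℕ t ≡ ½ * fromℕ n * fromℕ h - ½ * fromℕ p
halve t p n h eq = begin
  fromℕ t
    ≡⟨ solve 2 (λ t p → t := con ½ :* (con (fromℕ 2) :* t :+ p) :- con ½ :* p) refl (fromℕ t) (fromℕ p) ⟩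
  ½ * (fromℕ 2 * fromℕ t ℚ.+ fromℕ p) - ½ * fromℕ p
    ≡⟨ cong (λ x → ½ * x - ½ * fromℕ p) (begin
         fromℕ 2 * fromℕ t ℚ.+ fromℕ p   ≡⟨ cong (ℚ._+ fromℕ p) (fromℕ-* 2 t) ⟨
         fromℕ (2 ℕ.* t) ℚ.+ fromℕ p     ≡⟨ fromℕ-+ (2 ℕ.* t) p ⟨
         fromℕ (2 ℕ.* t + p)             ≡⟨ cong fromℕ eq ⟩
         fromℕ (n ℕ.* h)                 ≡⟨ fromℕ-* n h ⟩
         fromℕ n * fromℕ h               ∎) ⟩
  ½ * (fromℕ n * fromℕ h) - ½ * fromℕ p
    ≡⟨ cong (_- ½ * fromℕ p) (ℚ.*-assoc ½ (fromℕ n) (fromℕ h)) ⟨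
  ½ * fromℕ n * fromℕ h - ½ * fromℕ p
    ∎
  where
  open ≡-Reasoning
  open ℚSolver.+-*-Solver

theorem6 : (n : ℕ) → 1 ≤ n →
    (fromℕ (q n) ≡ ½ * fromℕ n * fromℕ (H n) - ½ * fromℕ (P n)) ×
    (fromℕ (r n) ≡ ½ * fromℕ n * fromℕ (P n) - ½ * fromℕ (P n)) ×
    (½ * fromℕ n * fromℕ (P n) - ½ * fromℕ (P n) ≡ (fromℕ n - 1ℚ) * ½ * fromℕ (P n))
theorem6 n@(suc m) _ =
    halve (q n) (P n) n (H n) (2q+P≡nH m)
  , halve (r n) (P n) n (P n) (2r+P≡nP m)
  , solve 2 (λ n p → con ½ :* n :* p :- con ½ :* p := (n :- con 1ℚ) :* con ½ :* p) refl
      (fromℕ n) (fromℕ (P n))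
  where open ℚSolver.+-*-Solver
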